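{- Let $n\ge 1$ and $f\ge 0$ be integers. If $S_d(n,f)\le 2d$, that is, if there is a search algorithm for $n$ robots, at most $f$ of which are byzantine faulty, whose search time for a target at (unknown) distance $d$ from the origin is at most $2d$ for every $d>0$, then $\frac{f}{n}\le \frac{3}{10}$.
   Context: Model. $n$ robots with distinct identities start at time $0$ at the origin of the real line and move along the line with speed at most $1$, changing direction or speed at no cost. A target lies at an unknown point at distance $d>0$ from the origin, i.e. at $d$ or $-d$, with $d$ unknown to the robots. At most $f$ robots are faulty; the bound $f$ is known, but not which robots are faulty. A search algorithm assigns each robot a trajectory, known to all robots; a robot's further motion may depend on the messages broadcast so far (computation and communication take no time). A robot detects whether the target is at a point only by being there. The only messages are announcements "the target is here", heard instantly by all robots at any distance; each message automatically carries the true identity and true current location of its sender. A robot visiting a point silently is taken to claim that the target is not there. Reliable (non-faulty) robots follow the algorithm and report truthfully. Faulty robots are controlled by an adversary: they may stay silent at the target or announce the target where it is not; a faulty robot that broadcasts while off its assigned trajectory is thereby detected as faulty. The search is completed at the first time when some reliable robot has visited the target and announced it and all reliable robots can be certain of its location (every scenario with at most $f$ faulty robots consistent with the messages so far has the target at that location). For an algorithm, the search time $S_d(n,f)$ is the worst-case completion time over both positions $\pm d$ of the target, all choices of at most $f$ faulty robots, and all behaviours of the faulty robots. The inequality $S_d(n,f)\le cd$ means that there is an algorithm, not depending on $d$, with search time at most $cd$ for every $d>0$. -}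

module Defs where

open import Level using (0ℓ)
open import Algebra.Bundles using (CommutativeRing)
open import Data.Fin.Base using (Fin)
open import Data.Fin.Subset using (Subset; _∉_; ∣_∣)
import Data.Nat.Base as ℕ
open import Data.Product.Base using (Σ; ∃; _×_)
open import Data.Sum.Base using (_⊎_)
open import Function.Bundles using (_⇔_)
open import Relation.Binary.Core using (Rel)
open import Relation.Binary.Definitions using (_Respects_)
open import Relation.Binary.Structures using (IsTotalOrder)
import Relation.Binary.Construct.NonStrictToStrict as NonStrictToStrict
open import Relation.Nullary.Negation.Core using (¬_)
open import Relation.Unary using (Pred)

-- The real numbers, axiomatised up to isomorphism as a Dedekind-complete
-- ordered field.  Equality is a setoid equality, since the usual
-- constructions of ℝ are quotients.

record RealNumbers : Set₁ where
  infix 4 _≤_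

  field
    commutativeRing : CommutativeRing 0ℓ 0ℓ

  open CommutativeRing commutativeRing public
    using (_≈_; _≉_; _+_; _*_; -_; _-_; 0#; 1#)
    renaming (Carrier to ℝ)

  field
    _≤_          : Rel ℝ 0ℓ
    isTotalOrder : IsTotalOrder _≈_ _≤_
    0≉1          : 0# ≉ 1#
    inverse      : ∀ x → x ≉ 0# → ∃ λ y → x * y ≈ 1#
    +-monoˡ-≤    : ∀ z {x y} → x ≤ y → x + z ≤ y + z
    *-nonNeg     : ∀ {x y} → 0# ≤ x → 0# ≤ y → 0# ≤ x * y

  open NonStrictToStrict _≈_ _≤_ public using (_<_)

  2# : ℝ
  2# = 1# + 1#

  _IsUpperBoundOf_ : ℝ → Pred ℝ 0ℓ → Set
  b IsUpperBoundOf P = ∀ x → P x → x ≤ b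

  field
    supremum : ∀ (P : Pred ℝ 0ℓ) → ∃ P → ∃ (_IsUpperBoundOf P) →
               ∃ λ s → s IsUpperBoundOf P ×
                       (∀ b → b IsUpperBoundOf P → s ≤ b)

module Search (R : RealNumbers) (n f : ℕ.ℕ) where
  open RealNumbers R

  Robot : Set
  Robot = Fin n

  -- Times are real numbers; only the values at nonnegative times matter.

  record Trajectory : Set where
    field
      position : ℝ → ℝ
      start    : position 0# ≈ 0#
      speed≤1  : ∀ s t → 0# ≤ s → s ≤ t →
                 position t - position s ≤ t - s ×
                 position s - position t ≤ t - s

  open Trajectory public

  FirstVisit : Trajectory → ℝ → ℝ → Set
  FirstVisit τ x t =
    position τ t ≈ x × (∀ s → 0# ≤ s → s < t → position τ s ≉ x)

  -- H i t p: at time t robot i broadcasts "the target is here", and p is the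
  -- location that the message carries.

  History : Set₁
  History = Robot → ℝ → ℝ → Set

  AgreeBefore AgreeUpTo : ℝ → History → History → Set
  AgreeBefore t H H′ = ∀ i s p → s < t → H i s p ⇔ H′ i s p
  AgreeUpTo   t H H′ = ∀ i s p → s ≤ t → H i s p ⇔ H′ i s p

  -- The whole history is passed to an algorithm, but by causality the
  -- position at time t may depend only on earlier messages.  Nothing is lost
  -- by excluding messages sent exactly at time t: motion is continuous, so
  -- these can influence only what happens after t.

  record Algorithm : Set₁ where
    field
      trajectory : History → Robot → Trajectory
      causal     : ∀ H H′ t → 0# ≤ t → AgreeBefore t H H′ →
                   ∀ i → position (trajectory H i) t ≈
                         position (trajectory H′ i) t

  open Algorithm public

  -- A complete course of events.  Faulty robots are constrained only by the
  -- physical speed limit and by the authenticity of the sender and location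
  -- of their messages.  A reliable robot declares its finding about a point
  -- when it first gets there, and does not repeat it on later visits.

  record Scenario (A : Algorithm) : Set₁ where
    field
      target         : ℝ
      target≉0       : target ≉ 0#
      faulty         : Subset n
      ∣faulty∣≤f     : ∣ faulty ∣ ℕ.≤ f
      path           : Robot → Trajectory
      announces      : Robot → ℝ → Set
      announces-resp : ∀ i → announces i Respects _≈_

    messages : History
    messages i t p = 0# ≤ t × announces i t × p ≈ position (path i) t

    field
      follows : ∀ i → i ∉ faulty → ∀ t → 0# ≤ t →
                position (path i) t ≈ position (trajectory A messages i) t
      reports : ∀ i → i ∉ faulty → ∀ t → 0# ≤ t →
                announces i t ⇔ FirstVisit (path i) target t

  open Scenario public

  FoundBy : ∀ {A} → Scenario A → ℝ → Set
  FoundBy S t =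
    ∃ λ i → i ∉ faulty S ×
    ∃ λ s → 0# ≤ s × s ≤ t × position (path S i) s ≈ target S × announces S i s

  CertainAt : ∀ {A} → Scenario A → ℝ → Set₁
  CertainAt {A} S t =
    ∀ (S′ : Scenario A) → AgreeUpTo t (messages S) (messages S′) →
    target S′ ≈ target S

  CompletedBy : ∀ {A} → Scenario A → ℝ → Set₁
  CompletedBy S t = FoundBy S t × CertainAt S t

  -- The search time of A for targets at distance d is at most T.

  SearchTime≤ : Algorithm → ℝ → ℝ → Set₁
  SearchTime≤ A d T =
    ∀ (S : Scenario A) → target S ≈ d ⊎ target S ≈ - d →
    ∃ λ t → t ≤ T × CompletedBy S t

  -- S_d(n,f) ≤ c d.  The algorithm is chosen before d.

  S≤ : ℝ → Set₁
  S≤ c = Σ Algorithm λ A → ∀ d → 0# < d → SearchTime≤ A d (c * d)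

{-# OPTIONS --safe #-}

-- The adversary only uses scenarios in which every robot follows the algorithm
-- and announces one point, fixed in advance by a plan, on its first visit; a
-- robot whose plan is a point too far away to be reached stays silent.
--
-- Take d = 1 and let σ be the side whose point is the first to have been seen by
-- f + 1 robots while nobody broadcasts, at time t say; let E be the set of robots
-- that have seen it by then.  If f robots of E keep silent and the others announce
-- the target, at least 2f + 1 robots must reach the point by time 2, as otherwise
-- the announcers could be the faulty ones.  The same attack on the other side
-- needs 2f + 1 visitors outside E, so |E| + 2f + 1 ≤ n.  If |E| ≤ 2f, then the
-- |E| − f announcers may be liars.  Just after time t it is too late for the 2f + 1
-- robots committed to σ to help on the other side, so a target there, at distance
-- u slightly above t, must be settled by the remaining robots although the adversary
-- can still corrupt g = 2f − |E| of them: 2f + 1 + 2g + 1 ≤ n.  Eliminating |E|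
-- gives 10f + 4 ≤ 3n.
module Submission where

open import Defs
open import Level using (0ℓ; Lift; lift; lower) renaming (suc to lsuc)
open import Algebra.Bundles using (CommutativeRing)
import Algebra.Properties.Ring as RingProperties
import Algebra.Solver.Ring.NaturalCoefficients.Default as SemiringSolver
open import Axiom.ExcludedMiddle using (ExcludedMiddle)
open import Data.Empty using (⊥; ⊥-elim)
open import Data.Bool.Base using (if_then_else_)
open import Data.Fin.Base using (Fin; zero; suc)
open import Data.Fin.Subset as Subset using (Subset; inside; outside; _∈_; _∉_; _⊆_; _∪_; ∣_∣)
open import Data.Fin.Subset.Properties as Subsetₚ using (_∈?_)
open import Data.Fin.Subset.Induction using (Acc; acc; ⊃-wellFounded)
open import Data.Nat.Base as ℕ using (ℕ; NonZero)
import Data.Nat.Properties as ℕₚ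
open import Data.Nat.Solver using (module +-*-Solver)
open import Data.Integer.Base as ℤ using (+_)
import Data.Integer.Properties as ℤₚ
import Data.Rational.Properties as ℚₚ
import Data.Rational.Unnormalised.Properties as ℚᵘₚ
open import Data.Rational.Unnormalised.Base using (mkℚᵘ; *≤*)
open import Data.Product.Base using (∃; _×_; _,_; proj₁; proj₂)
open import Data.Sum.Base using (_⊎_; inj₁; inj₂; [_,_]′)
open import Data.Vec.Base using ([]; _∷_; here; there; tabulate)
open import Data.Vec.Properties using (lookup⇒[]=; []=⇒lookup; lookup∘tabulate)
open import Function.Base using (_∘_; id; case_of_)
open import Function.Bundles using (_⇔_; mk⇔; Equivalence)
open import Relation.Binary.Core using (Rel)
open import Relation.Binary.Definitions using (Total; Transitive)
open import Relation.Binary.PropositionalEquality.Core as ≡ using (_≡_)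
import Relation.Binary.Construct.NonStrictToStrict as NonStrictToStrict
open import Relation.Binary.Structures using (IsTotalOrder)
open import Relation.Nullary.Decidable.Core using (Dec; yes; no; does; map′)
open import Relation.Nullary.Decidable using (dec-true; dec-false; decidable-stable)
open import Relation.Nullary.Negation.Core using (¬_; contradiction)
open import Relation.Unary using (Pred)

open Equivalence using (to; from)

private
  variable
    n : ℕ

-- Cardinalities of finite subsets.

∣p∣+∣q∣≤∣r∣ : {p q r : Subset n} → p ⊆ r → q ⊆ r → (∀ {i} → i ∈ p → i ∉ q) → ∣ p ∣ ℕ.+ ∣ q ∣ ℕ.≤ ∣ r ∣
∣tail∣ : ∀ {a b c} {p q r : Subset n} → a ∷ p ⊆ c ∷ r → b ∷ q ⊆ c ∷ r → (∀ {i} → i ∈ a ∷ p → i ∉ b ∷ q) →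
         ∣ p ∣ ℕ.+ ∣ q ∣ ℕ.≤ ∣ r ∣
∣tail∣ {p = p} {q = q} {r = r} p⊆r q⊆r p∩q =
  ∣p∣+∣q∣≤∣r∣ (Subsetₚ.drop-∷-⊆ p⊆r) (Subsetₚ.drop-∷-⊆ q⊆r) (λ i∈p i∈q → p∩q (there i∈p) (there i∈q))

∣p∣+∣q∣≤∣r∣ {p = []} {q = []} {r = []} p⊆r q⊆r p∩q = ℕ.z≤n
∣p∣+∣q∣≤∣r∣ {p = inside  ∷ p} {q = inside  ∷ q} {r = _ ∷ r} p⊆r q⊆r p∩q = ⊥-elim (p∩q here here)
∣p∣+∣q∣≤∣r∣ {p = inside  ∷ p} {q = outside ∷ q} {r = outside ∷ r} p⊆r q⊆r p∩q with () ← p⊆r here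
∣p∣+∣q∣≤∣r∣ {p = outside ∷ p} {q = inside  ∷ q} {r = outside ∷ r} p⊆r q⊆r p∩q with () ← q⊆r here
∣p∣+∣q∣≤∣r∣ {p = inside  ∷ p} {q = outside ∷ q} {r = inside ∷ r} p⊆r q⊆r p∩q = ℕ.s≤s (∣tail∣ p⊆r q⊆r p∩q)
∣p∣+∣q∣≤∣r∣ {p = outside ∷ p} {q = inside  ∷ q} {r = inside ∷ r} p⊆r q⊆r p∩q =
  ℕₚ.≤-trans (ℕₚ.≤-reflexive (ℕₚ.+-suc ∣ p ∣ ∣ q ∣)) (ℕ.s≤s (∣tail∣ p⊆r q⊆r p∩q))
∣p∣+∣q∣≤∣r∣ {p = outside ∷ p} {q = outside ∷ q} {r = c ∷ r} p⊆r q⊆r p∩q =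
  ℕₚ.≤-trans (∣tail∣ p⊆r q⊆r p∩q) (Subsetₚ.∣p∣≤∣x∷p∣ c r)

∣p∪q∣≤∣p∣+∣q∣ : (p q : Subset n) → ∣ p ∪ q ∣ ℕ.≤ ∣ p ∣ ℕ.+ ∣ q ∣
∣p∪q∣≤∣p∣+∣q∣ []            []            = ℕ.z≤n
∣p∪q∣≤∣p∣+∣q∣ (outside ∷ p) (outside ∷ q) = ∣p∪q∣≤∣p∣+∣q∣ p q
∣p∪q∣≤∣p∣+∣q∣ (inside  ∷ p) (outside ∷ q) = ℕ.s≤s (∣p∪q∣≤∣p∣+∣q∣ p q)
∣p∪q∣≤∣p∣+∣q∣ (outside ∷ p) (inside  ∷ q) =
  ℕₚ.≤-trans (ℕ.s≤s (∣p∪q∣≤∣p∣+∣q∣ p q)) (ℕₚ.≤-reflexive (≡.sym (ℕₚ.+-suc ∣ p ∣ ∣ q ∣)))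
∣p∪q∣≤∣p∣+∣q∣ (inside  ∷ p) (inside  ∷ q) =
  ℕ.s≤s (ℕₚ.≤-trans (∣p∪q∣≤∣p∣+∣q∣ p q) (ℕₚ.+-monoʳ-≤ ∣ p ∣ (ℕₚ.n≤1+n _)))

interpolate : {p r : Subset n} → ∀ k → p ⊆ r → ∣ p ∣ ℕ.≤ k → k ℕ.≤ ∣ r ∣ → ∃ λ q → p ⊆ q × q ⊆ r × ∣ q ∣ ≡ k
interpolate {p = []} {[]} ℕ.zero p⊆r _ _ = [] , id , id , ≡.refl
interpolate {p = outside ∷ p} {outside ∷ r} k p⊆r p≤k k≤r
  with interpolate k (Subsetₚ.drop-∷-⊆ p⊆r) p≤k k≤r
... | q , p⊆q , q⊆r , eq = outside ∷ q , Subsetₚ.s⊆s p⊆q , Subsetₚ.s⊆s q⊆r , eq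
interpolate {p = inside ∷ p} {outside ∷ r} k p⊆r p≤k k≤r with () ← p⊆r here
interpolate {p = inside ∷ p} {inside ∷ r} (ℕ.suc k) p⊆r (ℕ.s≤s p≤k) (ℕ.s≤s k≤r)
  with interpolate k (Subsetₚ.drop-∷-⊆ p⊆r) p≤k k≤r
... | q , p⊆q , q⊆r , eq = inside ∷ q , Subsetₚ.s⊆s p⊆q , Subsetₚ.s⊆s q⊆r , ≡.cong ℕ.suc eq
interpolate {p = outside ∷ p} {inside ∷ r} k p⊆r p≤k k≤r with k ℕₚ.≤? ∣ r ∣
... | yes k≤∣r∣ with interpolate k (Subsetₚ.drop-∷-⊆ p⊆r) p≤k k≤∣r∣
...   | q , p⊆q , q⊆r , eq = outside ∷ q , Subsetₚ.s⊆s p⊆q , Subsetₚ.out⊆ q⊆r , eq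
interpolate {p = outside ∷ p} {inside ∷ r} k p⊆r p≤k k≤r | no k≰∣r∣
  = inside ∷ r , p⊆r , id , ℕₚ.≤-antisym (ℕₚ.≰⇒> k≰∣r∣) k≤r

∣p∣>k⇒nonempty : ∀ {k} (p : Subset n) → k ℕ.< ∣ p ∣ → Subset.Nonempty p
∣p∣>k⇒nonempty {n} p k<∣p∣ with Subsetₚ.nonempty? p
... | yes nonempty = nonempty
... | no  empty    = contradiction
  (ℕₚ.<-≤-trans k<∣p∣ (ℕₚ.≤-reflexive (≡.trans (≡.cong ∣_∣ (Subsetₚ.Empty-unique empty)) (Subsetₚ.∣⊥∣≡0 n)))) λ ()

-- Arithmetic of the final counts.

counting-majority : ∀ {e f n} → ℕ.suc f ℕ.+ f ℕ.≤ e → e ℕ.+ (ℕ.suc f ℕ.+ f) ℕ.≤ n → 10 ℕ.* f ℕ.≤ 3 ℕ.* n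
counting-majority {e} {f} {n} 2f+1≤e e+2f+1≤n = begin
  10 ℕ.* f                                            ≤⟨ ℕₚ.m≤m+n (10 ℕ.* f) (2 ℕ.* f ℕ.+ 6) ⟩
  10 ℕ.* f ℕ.+ (2 ℕ.* f ℕ.+ 6)                        ≡⟨ solve 1 (λ f →
      con 10 :* f :+ (con 2 :* f :+ con 6) := con 3 :* ((con 1 :+ f :+ f) :+ (con 1 :+ f :+ f))) ≡.refl f ⟩
  3 ℕ.* ((ℕ.suc f ℕ.+ f) ℕ.+ (ℕ.suc f ℕ.+ f))         ≤⟨ ℕₚ.*-monoʳ-≤ 3 (ℕₚ.≤-trans (ℕₚ.+-monoˡ-≤ _ 2f+1≤e) e+2f+1≤n) ⟩
  3 ℕ.* n                                             ∎
  where
  open ℕₚ.≤-Reasoning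
  open +-*-Solver

-- Take `l + f + (2f + 1) ≤ n` twice and add the last hypothesis: the terms `2l` and `2g` combine
-- into `2f`, which gives `10f + 4 ≤ 3n`.
counting-split : ∀ {l g e f n} → l ℕ.+ g ≡ f → l ℕ.+ f ℕ.≤ e → e ℕ.+ (ℕ.suc f ℕ.+ f) ℕ.≤ n →
                 (ℕ.suc f ℕ.+ f) ℕ.+ (ℕ.suc g ℕ.+ g) ℕ.≤ n → 10 ℕ.* f ℕ.≤ 3 ℕ.* n
counting-split {l} {g} {e} {f} {n} ≡.refl l+f≤e e+2f+1≤n 2f+2g+2≤n = begin
  10 ℕ.* f                                            ≤⟨ ℕₚ.m≤m+n (10 ℕ.* f) 4 ⟩
  10 ℕ.* f ℕ.+ 4                                      ≡⟨ solve 2 (λ l g → let f = l :+ g in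
      con 10 :* f :+ con 4 := con 2 :* (l :+ f :+ (con 1 :+ f :+ f)) :+ ((con 1 :+ f :+ f) :+ (con 1 :+ g :+ g))) ≡.refl l g ⟩
  2 ℕ.* (l ℕ.+ f ℕ.+ (ℕ.suc f ℕ.+ f)) ℕ.+ ((ℕ.suc f ℕ.+ f) ℕ.+ (ℕ.suc g ℕ.+ g))
                                                      ≤⟨ ℕₚ.+-mono-≤ (ℕₚ.*-monoʳ-≤ 2 (ℕₚ.≤-trans (ℕₚ.+-monoˡ-≤ _ l+f≤e) e+2f+1≤n)) 2f+2g+2≤n ⟩
  2 ℕ.* n ℕ.+ n                                       ≡⟨ solve 1 (λ n → con 2 :* n :+ n := con 3 :* n) ≡.refl n ⟩
  3 ℕ.* n                                             ∎
  where
  open ℕₚ.≤-Reasoning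
  open +-*-Solver

-- Classical comprehension and extrema of finite unions.

module _ (em : ExcludedMiddle (lsuc 0ℓ)) where

  decide : (P : Set) → Dec P
  decide P = map′ lower lift (em {Lift (lsuc 0ℓ) P})

  by-contradiction : {P : Set} → ¬ ¬ P → P
  by-contradiction {P} = decidable-stable (decide P)

  opaque

    comprehension : (Fin n → Set) → Subset n
    comprehension P = tabulate (λ i → does (decide (P i)))

    ∈-comprehension⁺ : {P : Fin n → Set} {i : Fin n} → P i → i ∈ comprehension P
    ∈-comprehension⁺ {P = P} {i} Pi = lookup⇒[]= i _
      (≡.trans (lookup∘tabulate _ i) (dec-true (decide (P i)) Pi))

    ∈-comprehension⁻ : {P : Fin n → Set} {i : Fin n} → i ∈ comprehension P → P i
    ∈-comprehension⁻ {P = P} {i} i∈ = holds (decide (P i))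
      (≡.trans (≡.sym (lookup∘tabulate _ i)) ([]=⇒lookup i∈))
      where
      holds : (P? : Dec (P i)) → does P? ≡ inside → P i
      holds (yes Pi) _ = Pi

  module Extremum {A : Set} {_≼_ : Rel A 0ℓ} (total : Total _≼_) (trans : Transitive _≼_) where

    -- A set of times need not have a least element, but a finite union of sets with at most one
    -- element each is empty or has one. First broadcasts, arrivals and disagreements are found in
    -- this way, each robot contributing at most one time; reversing the order gives the last
    -- arrival.
    Extremal : Pred A 0ℓ → Set
    Extremal P = (∀ a → ¬ P a) ⊎ (∃ λ a → P a × (∀ b → P b → a ≼ b))

    extremal-≤1 : (P : Pred A 0ℓ) → (∀ {a b} → P a → P b → a ≼ b) → Extremal P
    extremal-≤1 P unique with decide (∃ P)
    ... | yes (a , Pa) = inj₂ (a , Pa , λ b Pb → unique Pa Pb)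
    ... | no ∄P        = inj₁ (λ a Pa → ∄P (a , Pa))

    extremal-⊎ : {P Q : Pred A 0ℓ} → Extremal P → Extremal Q → Extremal (λ a → P a ⊎ Q a)
    extremal-⊎ (inj₁ ∅P) (inj₁ ∅Q) = inj₁ (λ a → [ ∅P a , ∅Q a ]′)
    extremal-⊎ (inj₁ ∅P) (inj₂ (a , Qa , min)) =
      inj₂ (a , inj₂ Qa , λ b → [ (λ Pb → contradiction Pb (∅P b)) , min b ]′)
    extremal-⊎ (inj₂ (a , Pa , min)) (inj₁ ∅Q) =
      inj₂ (a , inj₁ Pa , λ b → [ min b , (λ Qb → contradiction Qb (∅Q b)) ]′)
    extremal-⊎ (inj₂ (a , Pa , minP)) (inj₂ (b , Qb , minQ)) with total a b
    ... | inj₁ a≼b = inj₂ (a , inj₁ Pa , λ c → [ minP c , (λ Qc → trans a≼b (minQ c Qc)) ]′)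
    ... | inj₂ b≼a = inj₂ (b , inj₂ Qb , λ c → [ (λ Pc → trans b≼a (minP c Pc)) , minQ c ]′)

    extremal-⋃ : ∀ {m} {P : Fin m → Pred A 0ℓ} → (∀ i → Extremal (P i)) → Extremal (λ a → ∃ λ i → P i a)
    extremal-⋃ {ℕ.zero}  ex = inj₁ (λ a ())
    extremal-⋃ {ℕ.suc m} ex with extremal-⊎ (ex zero) (extremal-⋃ (ex ∘ suc))
    ... | inj₁ none = inj₁ λ { a (zero , Pa) → none a (inj₁ Pa) ; a (suc i , Pa) → none a (inj₂ (i , Pa)) }
    ... | inj₂ (a , Pa , min) = inj₂
      ( a
      , [ (zero ,_) , (λ (i , Pi) → suc i , Pi) ]′ Pa
      , λ { b (zero , Pb) → min b (inj₁ Pb) ; b (suc i , Pb) → min b (inj₂ (i , Pb)) })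

-- Linear arithmetic in an ordered field.

module OrderedFieldProperties (R : RealNumbers) where
  open RealNumbers R public
  open CommutativeRing commutativeRing public
    using ( ring; commutativeSemiring; +-assoc; +-comm; +-cong; +-congˡ; +-congʳ; +-identityˡ; +-identityʳ
          ; -‿inverseˡ; -‿inverseʳ; *-congʳ; *-identityˡ; distribʳ)
    renaming (refl to ≈-refl; sym to ≈-sym; trans to ≈-trans; reflexive to ≡⇒≈)
  open SemiringSolver commutativeSemiring using (solve; _:+_; _:=_)
  open IsTotalOrder isTotalOrder public
    using (total; antisym; ≤-respˡ-≈; ≤-respʳ-≈)
    renaming (reflexive to ≤-reflexive; refl to ≤-refl; trans to ≤-trans)

  private
    module Strict = NonStrictToStrict _≈_ _≤_

  infixr 5 _≲_
  _≲_ : ∀ {a b c} → a ≤ b → b ≤ c → a ≤ c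
  _≲_ = ≤-trans

  opaque

    ≰⇒> : ∀ {a b} → ¬ (a ≤ b) → b < a
    ≰⇒> = Strict.≰⇒> ≈-sym ≤-reflexive total

    <⇒≱ : ∀ {a b} → a < b → ¬ (b ≤ a)
    <⇒≱ = Strict.<⇒≱ antisym

    <-≤-trans : ∀ {a b c} → a < b → b ≤ c → a < c
    <-≤-trans = Strict.<-≤-trans ≈-sym ≤-trans antisym ≤-respʳ-≈

    ≤-<-trans : ∀ {a b c} → a ≤ b → b < c → a < c
    ≤-<-trans = Strict.≤-<-trans ≤-trans antisym ≤-respˡ-≈

    +-mono-≤ : ∀ {a b c d} → a ≤ b → c ≤ d → a + c ≤ b + d
    +-mono-≤ {a} {b} {c} {d} a≤b c≤d = +-monoˡ-≤ c a≤b ≲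
      ≤-respˡ-≈ (+-comm c b) (≤-respʳ-≈ (+-comm d b) (+-monoˡ-≤ b c≤d))

    +-cancelʳ-≤ : ∀ c {a b} → a + c ≤ b + c → a ≤ b
    +-cancelʳ-≤ c {a} {b} a+c≤b+c = ≤-respˡ-≈ (x+y-y≈x a c) (≤-respʳ-≈ (x+y-y≈x b c) (+-monoˡ-≤ (- c) a+c≤b+c))
      where
      x+y-y≈x : ∀ x y → x + y - y ≈ x
      x+y-y≈x x y = ≈-trans (+-assoc x y (- y))
        (≈-trans (+-congˡ (-‿inverseʳ y)) (+-identityʳ x))

    -- Linear arithmetic without subtraction: a ≤ b because b − a = Y − X.
    ≤-from : ∀ {X Y a b} → X ≤ Y → a + Y ≈ b + X → a ≤ b
    ≤-from {X} {Y} {a} {b} X≤Y a+Y≈b+X =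
      +-cancelʳ-≤ Y (≤-reflexive a+Y≈b+X ≲ +-mono-≤ ≤-refl X≤Y)

    <-from : ∀ {X Y a b} → X < Y → a + Y ≈ b + X → a < b
    <-from {X} {Y} {a} {b} X<Y a+Y≈b+X = ≰⇒> λ b≤a →
      <⇒≱ X<Y (≤-from b≤a (≈-trans (+-comm Y a) (≈-trans a+Y≈b+X (+-comm b X))))

    a+b≰b : ∀ {a b} → 0# < a → ¬ (a + b ≤ b)
    a+b≰b {a} {b} 0<a a+b≤b = <⇒≱ 0<a (≤-from a+b≤b (≈-sym (+-identityˡ (a + b))))

    a-b+b≈a : ∀ a b → a - b + b ≈ a
    a-b+b≈a a b = ≈-trans (+-assoc a (- b) b)
      (≈-trans (+-congˡ (-‿inverseˡ b)) (+-identityʳ a))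

    a-b≤c-d⇒a+d≤c+b : ∀ {a b c d} → a - b ≤ c - d → a + d ≤ c + b
    a-b≤c-d⇒a+d≤c+b {a} {b} {c} {d} h = ≤-from h
      (≈-trans (+-congʳ (+-cong (≈-sym (a-b+b≈a a b)) ≈-refl))
      (≈-trans (solve 4 (λ a-b b d c-d → (a-b :+ b :+ d) :+ c-d := (c-d :+ d) :+ b :+ a-b)
                  ≈-refl (a - b) b d (c - d))
      (+-congʳ (+-congʳ (a-b+b≈a c d)))))

    0<1 : 0# < 1#
    0<1 with total 0# 1#
    ... | inj₁ 0≤1 = 0≤1 , 0≉1
    ... | inj₂ 1≤0 = ≤-respʳ-≈ -1*-1≈1 (*-nonNeg 0≤-1 0≤-1) , 0≉1
      where
      open RingProperties ring using (-‿involutive; -1*x≈-x)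
      0≤-1 : 0# ≤ - 1#
      0≤-1 = ≤-from 1≤0 (≈-trans (+-comm _ _) (≈-trans (+-identityʳ 0#) (≈-sym (-‿inverseˡ 1#))))
      -1*-1≈1 : - 1# * - 1# ≈ 1#
      -1*-1≈1 = ≈-trans (-1*x≈-x (- 1#)) (-‿involutive 1#)

    midpoint : ∀ a b → ∃ λ m → m + m ≈ a + b
    midpoint a b with inverse 2# (λ 2≈0 → <⇒≱ 0<1 (≤-from (proj₁ 0<1)
                        (≈-trans 2≈0 (≈-sym (+-identityʳ 0#)))))
    ... | ½ , 2*½≈1 = ½ * (a + b) , ≈-trans (≈-sym (distribʳ (a + b) ½ ½))
      (≈-trans (*-congʳ ½+½≈1) (*-identityˡ (a + b)))
      where
      ½+½≈1 : ½ + ½ ≈ 1#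
      ½+½≈1 = ≈-trans (+-cong (≈-sym (*-identityˡ ½)) (≈-sym (*-identityˡ ½)))
        (≈-trans (≈-sym (distribʳ ½ 1# 1#)) 2*½≈1)

    between : ∀ {a b} → a < b → ∃ λ m → a < m × m < b
    between {a} {b} a<b with midpoint a b
    ... | m , m+m≈a+b = m
      , ≰⇒> (λ m≤a → <⇒≱ a<b (≤-from (+-mono-≤ m≤a m≤a)
          (≈-trans (solve 2 (λ a b → b :+ (a :+ a) := a :+ (a :+ b)) ≈-refl a b) (+-congˡ (≈-sym m+m≈a+b)))))
      , ≰⇒> (λ b≤m → <⇒≱ a<b (≤-from (+-mono-≤ b≤m b≤m)
          (≈-trans (+-congˡ m+m≈a+b) (solve 2 (λ a b → b :+ (a :+ b) := a :+ (b :+ b)) ≈-refl a b))))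

-- Motion on the line and first visits.

data Side : Set where
  left right : Side

opposite : Side → Side
opposite left  = right
opposite right = left

module Motion (em : ExcludedMiddle (lsuc 0ℓ)) (R : RealNumbers) (n f : ℕ) where
  open OrderedFieldProperties R
  open SemiringSolver commutativeSemiring using (solve; _:+_; _:=_)
  open Search R n f

  ≮⇒≥ : ∀ {a b} → ¬ (a < b) → b ≤ a
  ≮⇒≥ a≮b = by-contradiction em (a≮b ∘ ≰⇒>)

  point : Side → ℝ → ℝ
  point right r = r
  point left  r = - r

  -- |a − b| ≤ t − s.
  Near : (a b s t : ℝ) → Set
  Near a b s t = a + s ≤ b + t × b + s ≤ a + t

  near-sym : ∀ {a b s t} → Near a b s t → Near b a s t
  near-sym (h , k) = k , h

  opaque

    near-trans : ∀ {a b c s t s′ t′} → Near a b s t → Near b c s′ t′ → Near a c (s + s′) (t + t′)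
    near-trans {a} {b} {c} {s} {t} {s′} {t′} (h , k) (h′ , k′) =
      ≤-from (+-mono-≤ h h′)
        (solve 7 (λ a b c s t s′ t′ → (a :+ (s :+ s′)) :+ ((b :+ t) :+ (c :+ t′)) := (c :+ (t :+ t′)) :+ ((a :+ s) :+ (b :+ s′)))
          ≈-refl a b c s t s′ t′) ,
      ≤-from (+-mono-≤ k k′)
        (solve 7 (λ a b c s t s′ t′ → (c :+ (s :+ s′)) :+ ((a :+ t) :+ (b :+ t′)) := (a :+ (t :+ t′)) :+ ((b :+ s) :+ (c :+ s′)))
          ≈-refl a b c s t s′ t′)

    near-resp : ∀ {a b c d s t} → a ≈ c → b ≈ d → Near a b s t → Near c d s t
    near-resp a≈c b≈d (h , k) =
      ≤-respˡ-≈ (+-congʳ a≈c) (≤-respʳ-≈ (+-congʳ b≈d) h) ,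
      ≤-respˡ-≈ (+-congʳ b≈d) (≤-respʳ-≈ (+-congʳ a≈c) k)

    -- The larger of the two points exceeds the other by `r + r′`, so one half of `Near` suffices:
    -- the first if `σ` is `right`, the second if it is `left`.
    opposite-sides-apart : ∀ σ {r r′ s t} → Near (point σ r) (point (opposite σ) r′) s t → r + r′ + s ≤ t
    opposite-sides-apart σ (h , k) = go σ h k
      where
      move : ∀ {r r′ s t} → r + s ≤ - r′ + t → r + r′ + s ≤ t
      move {r} {r′} {s} {t} h = ≤-from h
        (≈-trans (solve 5 (λ r r′ s t m → (r :+ r′ :+ s) :+ (m :+ t) := (r′ :+ m) :+ (t :+ (r :+ s))) ≈-refl r r′ s t (- r′))
        (≈-trans (+-congʳ (-‿inverseʳ r′)) (+-identityˡ _)))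
      go : ∀ σ {r r′ s t} → point σ r + s ≤ point (opposite σ) r′ + t →
           point (opposite σ) r′ + s ≤ point σ r + t → r + r′ + s ≤ t
      go right h k = move h
      go left  h k = ≤-respˡ-≈ (+-congʳ (+-comm _ _)) (move k)

    lipschitz : ∀ τ {s t} → 0# ≤ s → s ≤ t → Near (position τ s) (position τ t) s t
    lipschitz τ {s} {t} 0≤s s≤t with speed≤1 τ s t 0≤s s≤t
    ... | h , k = a-b≤c-d⇒a+d≤c+b′ k , a-b≤c-d⇒a+d≤c+b′ h
      where
      a-b≤c-d⇒a+d≤c+b′ : ∀ {a b c d} → a - b ≤ c - d → a + d ≤ b + c
      a-b≤c-d⇒a+d≤c+b′ p = ≤-respʳ-≈ (+-comm _ _) (a-b≤c-d⇒a+d≤c+b p)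

    position-cong : ∀ τ {s t} → 0# ≤ s → s ≈ t → position τ s ≈ position τ t
    position-cong τ {s} {t} 0≤s s≈t with lipschitz τ 0≤s (≤-reflexive s≈t)
    ... | h , k = antisym (+-cancelʳ-≤ s (≤-respʳ-≈ (+-congˡ (≈-sym s≈t)) h))
                          (+-cancelʳ-≤ s (≤-respʳ-≈ (+-congˡ (≈-sym s≈t)) k))

    distance≤time : ∀ σ τ {r t} → 0# ≤ t → position τ t ≈ point σ r → r ≤ t
    -- The origin, where the robot starts, serves as the point at distance 0 on the opposite side.
    distance≤time σ τ {r} {t} 0≤t at = ≤-respˡ-≈ (≈-trans (+-identityʳ _) (+-identityʳ r))
      (opposite-sides-apart σ (near-sym (near-resp (≈-trans (start τ) (0≈ (opposite σ))) at (lipschitz τ ≤-refl 0≤t))))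
      where
      0≈ : ∀ σ → 0# ≈ point σ 0#
      0≈ right = ≈-refl
      0≈ left  = ≈-sym (RingProperties.-0#≈0# ring)

    visits-both-sides : ∀ σ τ {r r′ s s′} → 0# ≤ s → 0# ≤ s′ →
      position τ s ≈ point σ r → position τ s′ ≈ point (opposite σ) r′ →
      (r + r′ + s ≤ s′) ⊎ (r + r′ + s′ ≤ s)
    visits-both-sides σ τ {s = s} {s′} 0≤s 0≤s′ at at′ with total s s′
    ... | inj₁ s≤s′ = inj₁ (opposite-sides-apart σ (near-resp at at′ (lipschitz τ 0≤s s≤s′)))
    ... | inj₂ s′≤s = inj₂ (opposite-sides-apart σ (near-sym (near-resp at′ at (lipschitz τ 0≤s′ s′≤s))))

    first-visit-unique : ∀ {τ x s t} → 0# ≤ s → 0# ≤ t → FirstVisit τ x s → FirstVisit τ x t → s ≤ t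
    first-visit-unique {t = t} 0≤s 0≤t (_ , before) (at , _) = ≮⇒≥ λ t<s → before t 0≤t t<s at

  module _ (τ : Trajectory) {x t : ℝ} (0≤t : 0# ≤ t) (at : position τ t ≈ x) where

    private
      Unvisited : Pred ℝ 0ℓ
      Unvisited r = 0# ≤ r × (∀ q → 0# ≤ q → q < r → position τ q ≉ x)

      unvisited-bounded : ∀ {q} → 0# ≤ q → position τ q ≈ x → q IsUpperBoundOf Unvisited
      unvisited-bounded {q} 0≤q at-q r (_ , unvisited) = ≮⇒≥ λ q<r → unvisited q 0≤q q<r at-q

      unvisited-0 : Unvisited 0#
      unvisited-0 = ≤-refl , λ q 0≤q q<0 → contradiction 0≤q (<⇒≱ q<0)

    opaque

      -- The first visit is the supremum of `Unvisited`. Any visit time is an upper bound of that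
      -- set, so none precedes the supremum; and were the robot away from `x` at the supremum, the
      -- speed limit would keep it away a little longer.
      first-visit-exists : ∃ λ s → 0# ≤ s × s ≤ t × FirstVisit τ x s
      first-visit-exists with supremum Unvisited (0# , unvisited-0) (t , unvisited-bounded 0≤t at)
      ... | s , upper , least =
        s , 0≤s , least t (unvisited-bounded 0≤t at) , antisym (no-gap proj₁) (no-gap proj₂) , before-s
        where
        0≤s : 0# ≤ s
        0≤s = upper 0# unvisited-0
        before-s : ∀ q → 0# ≤ q → q < s → position τ q ≉ x
        before-s q 0≤q q<s at-q = <⇒≱ q<s (least q (unvisited-bounded 0≤q at-q))
        -- At distance b − a > 0 from x at time s, the robot cannot reach x before s + (b − a).
        no-gap : ∀ {a b} → (∀ {q} → Near (position τ s) x s q → b + s ≤ a + q) → b ≤ a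
        no-gap {a} {b} far = ≮⇒≥ λ a<b → let s<s+b-a = s<s+[b-a] a<b in
          <⇒≱ s<s+b-a (upper (s + (b - a)) (0≤s ≲ proj₁ s<s+b-a , unvisited))
          where
          s+b≈ : s + b ≈ a + (s + (b - a))
          s+b≈ = ≈-trans (+-congˡ (≈-sym (a-b+b≈a b a)))
            (solve 3 (λ s a b-a → s :+ (b-a :+ a) := a :+ (s :+ b-a)) ≈-refl s a (b - a))
          s<s+[b-a] : a < b → s < s + (b - a)
          s<s+[b-a] a<b = <-from a<b (≈-trans s+b≈ (+-comm _ _))
          unvisited : ∀ q → 0# ≤ q → q < s + (b - a) → position τ q ≉ x
          unvisited q 0≤q q<s+b-a at-q with decide em (s ≤ q)
          ... | no  s≰q = before-s q 0≤q (≰⇒> s≰q) at-q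
          ... | yes s≤q = <⇒≱ q<s+b-a (≤-from (far (near-resp ≈-refl at-q (lipschitz τ 0≤s s≤q)))
            (≈-trans (solve 4 (λ s b-a a q → (s :+ b-a) :+ (a :+ q) := q :+ (a :+ (s :+ b-a))) ≈-refl s (b - a) a q)
                     (+-congˡ (≈-trans (≈-sym s+b≈) (+-comm s b)))))

  -- Histories produced by plans.

  module Play (A : Algorithm) where

    open Extremum em {_≼_ = _≤_} total ≤-trans
    module Latest = Extremum em {_≼_ = λ r s → s ≤ r} (λ r s → total s r) (λ s≤r t≤s → t≤s ≲ s≤r)

    track : History → Robot → ℝ → ℝ
    track H i = position (trajectory A H i)

    Declares : (Robot → ℝ) → History → Robot → ℝ → Set
    Declares p H i t = 0# ≤ t × FirstVisit (trajectory A H i) (p i) t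

    -- The broadcasts resulting from plan p when the robots hear the history H.
    Response : (Robot → ℝ) → History → History
    Response p H i t x = Declares p H i t × x ≈ track H i t

    declares-unique : ∀ p {H i s t} → Declares p H i s → Declares p H i t → s ≤ t
    declares-unique p {H} {i} (0≤s , first) (0≤t , first′) =
      first-visit-unique {trajectory A H i} 0≤s 0≤t first first′

    module _ {H H′ : History} {t : ℝ} (agree : AgreeBefore t H H′) where

      -- Agreement strictly before `t` settles the positions at `t` as well, since `causal` admits
      -- only earlier messages. Hence past broadcasts determine the next ones.
      same-track : ∀ i {s} → 0# ≤ s → s ≤ t → track H i s ≈ track H′ i s
      same-track i {s} 0≤s s≤t =
        causal A H H′ s 0≤s (λ j r x r<s → agree j r x (<-≤-trans r<s s≤t)) i

      response-cong : ∀ {p p′ i s x} → p i ≈ p′ i → s ≤ t → Response p H i s x → Response p′ H′ i s x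
      response-cong {i = i} p≈p′ s≤t ((0≤s , at , before) , x≈) =
        (0≤s , ≈-trans (≈-sym (same-track i 0≤s s≤t)) (≈-trans at p≈p′) ,
          λ r 0≤r r<s at-r → before r 0≤r r<s
            (≈-trans (same-track i 0≤r (proj₁ r<s ≲ s≤t)) (≈-trans at-r (≈-sym p≈p′)))) ,
        ≈-trans x≈ (same-track i 0≤s s≤t)

    agree-sym : ∀ {H H′ t} → AgreeBefore t H H′ → AgreeBefore t H′ H
    agree-sym agree i s x s<t = mk⇔ (from (agree i s x s<t)) (to (agree i s x s<t))

    module _ (p : Robot → ℝ) where

      private
        UpTo : ℝ → History → Set
        UpTo t H = ∀ i s x → H i s x ⇔ (s ≤ t × Response p H i s x)

        declared : History → Subset n
        declared H = comprehension em (λ i → ∃ λ s → ∃ λ x → H i s x)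

        -- Adding the next broadcasts to a history that is correct up to time t; this
        -- stops because every robot broadcasts at most once.
        extend : ∀ {t H} → UpTo t H → Acc Subset._⊃_ (declared H) →
                 ∃ λ H → ∀ i s x → H i s x ⇔ Response p H i s x
        extend {t} {H} ok (acc rec)
          with extremal-⋃ {P = λ i s → t < s × Declares p H i s}
                 (λ i → extremal-≤1 _ (λ a b → declares-unique p (proj₂ a) (proj₂ b)))
        ... | inj₁ none = H , λ i s x → mk⇔ (proj₂ ∘ to (ok i s x))
          (λ resp → from (ok i s x) (≮⇒≥ (λ t<s → none s (i , t<s , proj₁ resp)) , resp))
        ... | inj₂ (u , (j , t<u , j-declares) , least) = extend ok′ (rec (grows , j , ∈-comprehension⁺ em j∈ , j∉))
          where
          H′ : History
          H′ i s x = s ≤ u × Response p H i s x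
          -- Nobody responding to `H` declares between `t` and `u`, so truncating the response at
          -- `u` changes nothing before `u`; by causality the responses to `H` and `H′` then
          -- coincide up to and including `u`.
          agree : AgreeBefore u H H′
          agree i s x s<u = mk⇔ (λ h → proj₁ s<u , proj₂ (to (ok i s x) h))
            (λ (_ , resp) → from (ok i s x) (≮⇒≥ (λ t<s → <⇒≱ s<u (least s (i , t<s , proj₁ resp))) , resp))
          ok′ : UpTo u H′
          ok′ i s x = mk⇔ (λ (s≤u , resp) → s≤u , response-cong agree {p} {p} ≈-refl s≤u resp)
                          (λ (s≤u , resp) → s≤u , response-cong (agree-sym agree) {p} {p} ≈-refl s≤u resp)
          grows : declared H ⊆ declared H′
          grows i∈ with ∈-comprehension⁻ em i∈
          ... | s , x , h with to (ok _ s x) h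
          ...   | s≤t , resp = ∈-comprehension⁺ em (s , x , s≤t ≲ proj₁ t<u , resp)
          j∈ : ∃ λ s → ∃ λ x → H′ j s x
          j∈ = u , track H j u , ≤-refl , j-declares , ≈-refl
          j∉ : j ∉ declared H
          j∉ j∈ with ∈-comprehension⁻ em j∈
          ... | s , x , h with to (ok j s x) h
          ...   | s≤t , declares , _ = <⇒≱ t<u (declares-unique p j-declares declares ≲ s≤t)

        -- The condition is circular, since tracks depend on broadcasts and broadcasts on tracks;
        -- causality allows it to be solved forward in time.
        fixpoint : ∃ λ H → ∀ i s x → H i s x ⇔ Response p H i s x
        -- Declarations have nonnegative times, so the empty history is correct up to time -1.
        fixpoint = extend {(- 1#)} {λ _ _ _ → ⊥}
          (λ i s x → mk⇔ ⊥-elim (λ (s≤-1 , (0≤s , _) , _) → <⇒≱ 0<1 (≤-from (0≤s ≲ s≤-1) 1-1≈0+0)))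
          (⊃-wellFounded _)
          where
          1-1≈0+0 : 1# - 1# ≈ 0# + 0#
          1-1≈0+0 = ≈-trans (-‿inverseʳ 1#) (≈-sym (+-identityʳ 0#))

      opaque
        play : History
        play = proj₁ fixpoint

        play-response : ∀ i s x → play i s x ⇔ Response p play i s x
        play-response = proj₂ fixpoint

    module _ (p p′ : Robot → ℝ) (D : Pred ℝ 0ℓ) (down : ∀ {r s} → r < s → D s → D r)
             (same : ∀ i → p i ≈ p′ i ⊎ (∀ s → 0# ≤ s → D s → track (play p) i s ≉ p i × track (play p) i s ≉ p′ i))
             where

      private
        before : ∀ {s} → D s → AgreeBefore s (play p) (play p′) → ∀ i x → play p i s x ⇔ play p′ i s x
        before {s} Ds agree i x = mk⇔ (from (play-response p′ i s x) ∘ ⇒ (same i) ∘ to (play-response p i s x))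
                                      (from (play-response p i s x) ∘ ⇐ (same i) ∘ to (play-response p′ i s x))
          where
          Same = p i ≈ p′ i ⊎ (∀ s → 0# ≤ s → D s → track (play p) i s ≉ p i × track (play p) i s ≉ p′ i)
          ⇒ : Same → Response p (play p) i s x → Response p′ (play p′) i s x
          ⇒ (inj₁ p≈p′) resp = response-cong agree {p} {p′} p≈p′ ≤-refl resp
          ⇒ (inj₂ avoids) ((0≤s , at , _) , _) = contradiction at (proj₁ (avoids s 0≤s Ds))
          ⇐ : Same → Response p′ (play p′) i s x → Response p (play p) i s x
          ⇐ (inj₁ p≈p′) resp = response-cong (agree-sym agree) {p′} {p} (≈-sym p≈p′) ≤-refl resp
          ⇐ (inj₂ avoids) ((0≤s , at , _) , _) =
            contradiction (≈-trans (same-track agree i 0≤s ≤-refl) at) (proj₂ (avoids s 0≤s Ds))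

        Disagree : History → History → Robot → Pred ℝ 0ℓ
        Disagree H H′ i s = D s × ∃ λ x → H i s x × ¬ H′ i s x

        disagree-extremal : ∀ q H′ i → Extremal (Disagree (play q) H′ i)
        disagree-extremal q H′ i = extremal-≤1 _ λ { {a} {b} (_ , x , h , _) (_ , y , k , _) →
          declares-unique q (proj₁ (to (play-response q i a x) h)) (proj₁ (to (play-response q i b y) k)) }

      -- At the earliest disagreement the robots have so far heard the same messages and moved
      -- alike, so by `same` they also broadcast alike, a contradiction. Avoidance is therefore only
      -- required along `play p`. The initial segment `D` may be closed or open on the right; both
      -- cases occur.
      play-agree : ∀ i s x → D s → play p i s x ⇔ play p′ i s x
      play-agree i s x Ds with extremal-⊎ (extremal-⋃ (disagree-extremal p (play p′)))
                                          (extremal-⋃ (disagree-extremal p′ (play p)))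
      ... | inj₁ none = mk⇔
        (λ h  → by-contradiction em λ ¬h′ → none s (inj₁ (i , Ds , x , h , ¬h′)))
        (λ h′ → by-contradiction em λ ¬h  → none s (inj₂ (i , Ds , x , h′ , ¬h)))
      ... | inj₂ (u , first , least) = contradiction first λ
        { (inj₁ (j , Du , y , h , ¬h′)) → ¬h′ (to (before Du (agree Du) j y) h)
        ; (inj₂ (j , Du , y , h′ , ¬h)) → ¬h (from (before Du (agree Du) j y) h′) }
        where
        agree : D u → AgreeBefore u (play p) (play p′)
        agree Du j r y r<u = mk⇔
          (λ h  → by-contradiction em λ ¬h′ → <⇒≱ r<u (least r (inj₁ (j , down r<u Du , y , h , ¬h′))))
          (λ h′ → by-contradiction em λ ¬h  → <⇒≱ r<u (least r (inj₂ (j , down r<u Du , y , h′ , ¬h))))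

    -- Scenarios built from plans.

    module _ (p : Robot → ℝ) (y : ℝ) (y≉0 : y ≉ 0#) (B : Subset n) (∣B∣≤f : ∣ B ∣ ℕ.≤ f)
             (honest : ∀ i → i ∉ B → p i ≈ y) where

      private
        messages⇔play : ∀ i t x → (0# ≤ t × Declares p (play p) i t × x ≈ track (play p) i t) ⇔ play p i t x
        messages⇔play i t x = mk⇔ (λ (_ , resp) → from (play-response p i t x) resp)
          (λ h → let resp = to (play-response p i t x) h in proj₁ (proj₁ resp) , resp)

        declares-resp : ∀ i {s t} → s ≈ t → Declares p (play p) i s → Declares p (play p) i t
        declares-resp i s≈t (0≤s , at , before) = ≤-respʳ-≈ s≈t 0≤s ,
          ≈-trans (≈-sym (position-cong (trajectory A (play p) i) 0≤s s≈t)) at ,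
          λ r 0≤r r<t → before r 0≤r (<-≤-trans r<t (≤-reflexive (≈-sym s≈t)))

      -- Faulty robots also move as prescribed and betray nothing except through the point they
      -- announce. The messages thus depend on the plan alone, neither on the target nor on who is
      -- faulty, so that agreement of plays makes scenarios indistinguishable.
      scenario : Scenario A
      scenario = record
        { target         = y
        ; target≉0       = y≉0
        ; faulty         = B
        ; ∣faulty∣≤f     = ∣B∣≤f
        ; path           = trajectory A (play p)
        ; announces      = Declares p (play p)
        ; announces-resp = declares-resp
        ; follows        = λ i _ t 0≤t → causal A _ _ t 0≤t
            (λ j s x _ → mk⇔ (from (messages⇔play j s x)) (to (messages⇔play j s x))) i
        ; reports        = λ i i∉B t 0≤t → mk⇔
            (retarget (trajectory A (play p) i) (honest i i∉B) ∘ proj₂)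
            (λ first → 0≤t , retarget (trajectory A (play p) i) (≈-sym (honest i i∉B)) first)
        }
        where
        retarget : ∀ τ {a b t} → a ≈ b → FirstVisit τ a t → FirstVisit τ b t
        retarget τ a≈b (at , before) =
          ≈-trans at a≈b , λ s 0≤s s<t at-s → before s 0≤s s<t (≈-trans at-s (≈-sym a≈b))

      messages-scenario : ∀ i t x → messages scenario i t x ⇔ play p i t x
      messages-scenario = messages⇔play

    override : Subset n → ℝ → (Robot → ℝ) → Robot → ℝ
    override C y b i = if does (i ∈? C) then y else b i

    override-∈ : ∀ {C y b i} → i ∈ C → override C y b i ≡ y
    override-∈ {C} {y} {b} {i} i∈C rewrite dec-true (i ∈? C) i∈C = ≡.refl

    override-∉ : ∀ {C y b i} → i ∉ C → override C y b i ≡ b i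
    override-∉ {C} {y} {b} {i} i∉C rewrite dec-false (i ∈? C) i∉C = ≡.refl

    visitors : Subset n → (Robot → ℝ) → ℝ → Pred ℝ 0ℓ → Subset n
    visitors Y p y D = comprehension em (λ i → i ∉ Y × ∃ λ s → 0# ≤ s × D s × track (play p) i s ≈ y)

    -- The robots in Y are known to be faulty in every scenario considered, and under
    -- the plan b nobody else broadcasts.  The attack begins when more than g other
    -- robots have visited y: exactly g of these visitors stay silent, and all other
    -- robots outside Y announce y.
    record Attack (Y : Subset n) (b : Robot → ℝ) (y T : ℝ) (g : ℕ) : Set where
      field
        time          : ℝ
        time≤T        : time ≤ T
        silent        : Subset n
        ∣silent∣      : ∣ silent ∣ ≡ g
        silent⊆       : silent ⊆ visitors Y b y (_≤ time)

      attack : Robot → ℝ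
      attack = override (Subset.∁ (Y ∪ silent)) y b

      field
        agree         : AgreeBefore time (play b) (play attack)
        many-visitors : ℕ.suc g ℕ.+ g ℕ.≤ ∣ visitors Y attack y (_≤ T) ∣
        more-than-g  : g ℕ.< ∣ visitors Y b y (_≤ time) ∣

    -- Existence of an attack.

    module _ (Y : Subset n) (b : Robot → ℝ) (y z T : ℝ) (g : ℕ) (∣Y∣+g≤f : ∣ Y ∣ ℕ.+ g ℕ.≤ f)
             (y≉0 : y ≉ 0#) (z≉0 : z ≉ 0#)
             (b≈z : ∀ i → i ∉ Y → b i ≈ z)
             (far : ∀ p i s → 0# ≤ s → s ≤ T → track (play p) i s ≉ z)
             (complete : ∀ (S : Scenario A) → target S ≈ y → ∃ λ t → t ≤ T × CompletedBy S t)
             where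

      private
        N : Pred ℝ 0ℓ → Subset n
        N = visitors Y b y

        plan : Subset n → Robot → ℝ
        plan E = override (Subset.∁ (Y ∪ E)) y b

        -- The two plans differ only outside `Y ∪ E`, where `b` prescribes `z` and `plan E`
        -- prescribes `y`. Neither is reached there during `D`: `z` is too far, and the visitors of
        -- `y` outside `Y` all lie in `E`.
        silence-agree : ∀ {E} (D : Pred ℝ 0ℓ) → (∀ {r s} → r < s → D s → D r) → (∀ {s} → D s → s ≤ T) →
                        N D ⊆ E → ∀ i s x → D s → play b i s x ⇔ play (plan E) i s x
        silence-agree {E} D down ≤T N⊆E = play-agree b (plan E) D down same
          where
          same : ∀ i → b i ≈ plan E i ⊎ (∀ s → 0# ≤ s → D s → track (play b) i s ≉ b i × track (play b) i s ≉ plan E i)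
          same i with i ∈? Subset.∁ (Y ∪ E)
          ... | no  _  = inj₁ ≈-refl
          ... | yes i∈ = inj₂ λ s 0≤s Ds →
            (λ at → far b i s 0≤s (≤T Ds) (≈-trans at (b≈z i i∉Y))) ,
            (λ at → i∉E (N⊆E (∈-comprehension⁺ em (i∉Y , s , 0≤s , Ds , at))))
            where
            i∉Y : i ∉ Y
            i∉Y i∈Y = Subsetₚ.x∈∁p⇒x∉p i∈ (Subsetₚ.x∈p∪q⁺ (inj₁ i∈Y))
            i∉E : i ∉ E
            i∉E i∈E = Subsetₚ.x∈∁p⇒x∉p i∈ (Subsetₚ.x∈p∪q⁺ {p = Y} (inj₂ i∈E))

        ∣Y∪E∣≤f : ∀ {E} → ∣ E ∣ ℕ.≤ g → ∣ Y ∪ E ∣ ℕ.≤ f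
        ∣Y∪E∣≤f {E} ∣E∣≤g = ℕₚ.≤-trans (∣p∪q∣≤∣p∣+∣q∣ Y E) (ℕₚ.≤-trans (ℕₚ.+-monoʳ-≤ ∣ Y ∣ ∣E∣≤g) ∣Y∣+g≤f)

        plan-honest : ∀ E i → i ∉ Y ∪ E → plan E i ≈ y
        plan-honest E i i∉ = ≡⇒≈ (override-∈ {b = b} (Subsetₚ.x∉p⇒x∈∁p i∉))

        attacked : ∀ E → ∣ E ∣ ℕ.≤ g → Scenario A
        attacked E ∣E∣≤g = scenario (plan E) y y≉0 (Y ∪ E) (∣Y∪E∣≤f ∣E∣≤g) (plan-honest E)

        -- Otherwise all these visitors could be faulty and silent. The robots would then move as
        -- under `b` up to time `T`, and no reliable one would find the target.
        g<∣N≤T∣ : g ℕ.< ∣ N (_≤ T) ∣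
        g<∣N≤T∣ = ℕₚ.≰⇒> λ ∣E∣≤g → case complete (attacked (N (_≤ T)) ∣E∣≤g) ≈-refl of λ
          { (t , t≤T , (i , i∉ , s , 0≤s , s≤t , at , _) , _) →
              i∉ (Subsetₚ.x∈p∪q⁺ {p = Y} (inj₂ (∈-comprehension⁺ em
                ( (λ i∈Y → i∉ (Subsetₚ.x∈p∪q⁺ (inj₁ i∈Y))) , s , 0≤s , s≤t ≲ t≤T
                , ≈-trans (same-track (agree (s≤t ≲ t≤T)) i 0≤s ≤-refl) at)))) }
          where
          agree : ∀ {s} → s ≤ T → AgreeBefore s (play b) (play (plan (N (_≤ T))))
          agree s≤T j r x r<s =
            silence-agree (_≤ T) (λ r<s s≤T → proj₁ r<s ≲ s≤T) id id j r x (proj₁ r<s ≲ s≤T)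

        Arrival : Robot → Pred ℝ 0ℓ
        Arrival i s = i ∉ Y × Declares (λ _ → y) (play b) i s

        -- The set of visitors grows only at first visits, so after the last of them in `D` it is
        -- complete. This reduces the search for the critical time to the finitely many arrival
        -- times.
        latest-arrival : ∀ (D : Pred ℝ 0ℓ) → (∀ {r s} → r ≤ s → D s → D r) → g ℕ.< ∣ N D ∣ →
                         ∃ λ u → D u × (∃ λ i → Arrival i u) × g ℕ.< ∣ N (_≤ u) ∣
        latest-arrival D down g<∣ND∣ with Latest.extremal-⋃ {P = λ i s → Arrival i s × D s}
          (λ i → Latest.extremal-≤1 _ (λ { ((_ , a) , _) ((_ , a′) , _) → declares-unique (λ _ → y) {play b} a′ a }))
        ... | inj₁ none with ∣p∣>k⇒nonempty (N D) g<∣ND∣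
        ...   | i , i∈N with ∈-comprehension⁻ em i∈N
        ...     | i∉Y , s , 0≤s , Ds , at with first-visit-exists (trajectory A (play b) _) 0≤s at
        ...       | r , 0≤r , r≤s , first = contradiction (_ , (i∉Y , 0≤r , first) , down r≤s Ds) (none r)
        latest-arrival D down g<∣ND∣ | inj₂ (u , (j , arrival , Du) , greatest) =
          u , Du , (j , arrival) , ℕₚ.≤-trans g<∣ND∣ (Subsetₚ.p⊆q⇒∣p∣≤∣q∣ N⊆N≤u)
          where
          N⊆N≤u : N D ⊆ N (_≤ u)
          N⊆N≤u i∈N with ∈-comprehension⁻ em i∈N
          ... | i∉Y , s , 0≤s , Ds , at with first-visit-exists (trajectory A (play b) _) 0≤s at
          ...   | r , 0≤r , r≤s , first = ∈-comprehension⁺ em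
            (i∉Y , r , 0≤r , greatest r (_ , (i∉Y , 0≤r , first) , down r≤s Ds) , proj₁ first)

        critical-time : ∃ λ t → t ≤ T × ∣ N (_< t) ∣ ℕ.≤ g × g ℕ.< ∣ N (_≤ t) ∣
        critical-time with extremal-⋃ {P = λ i s → Arrival i s × s ≤ T × g ℕ.< ∣ N (_≤ s) ∣}
          (λ i → extremal-≤1 _ (λ { ((_ , a) , _) ((_ , a′) , _) → declares-unique (λ _ → y) {play b} a a′ }))
        ... | inj₁ none with latest-arrival (_≤ T) (λ r≤s s≤T → r≤s ≲ s≤T) g<∣N≤T∣
        ...   | u , u≤T , (i , arrival) , g<∣N≤u∣ = contradiction (i , arrival , u≤T , g<∣N≤u∣) (none u)
        critical-time | inj₂ (t , (j , _ , t≤T , g<∣N≤t∣) , least) = t , t≤T , ∣N<t∣≤g , g<∣N≤t∣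
          where
          ∣N<t∣≤g : ∣ N (_< t) ∣ ℕ.≤ g
          ∣N<t∣≤g with ∣ N (_< t) ∣ ℕₚ.≤? g
          ... | yes ≤g = ≤g
          ... | no  ≰g with latest-arrival (_< t) (λ r≤s s<t → ≤-<-trans r≤s s<t) (ℕₚ.≰⇒> ≰g)
          ...   | u , u<t , (i , arrival) , g<∣N≤u∣ =
            contradiction (least u (i , arrival , proj₁ u<t ≲ t≤T , g<∣N≤u∣)) (<⇒≱ u<t)

      opaque
        attack-exists : Attack Y b y T g
        attack-exists with critical-time
        ... | t , t≤T , ∣N<t∣≤g , g<∣N≤t∣
          -- Containing all visitors before `t`, the silent set `E` delays every new announcement
          -- until `t`; consisting of visitors by `t`, it still counts among the visitors during the
          -- attack.
          with interpolate g (λ i∈ → case ∈-comprehension⁻ em i∈ of λ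
                 { (i∉Y , s , 0≤s , s<t , at) → ∈-comprehension⁺ em (i∉Y , s , 0≤s , proj₁ s<t , at) })
                 ∣N<t∣≤g (ℕₚ.<⇒≤ g<∣N≤t∣)
        ... | E , N<t⊆E , E⊆N≤t , ∣E∣≡g = record
          { time          = t
          ; time≤T        = t≤T
          ; silent        = E
          ; ∣silent∣      = ∣E∣≡g
          ; silent⊆       = E⊆N≤t
          ; agree         = agree
          ; many-visitors = ℕₚ.≤-trans (ℕₚ.+-mono-≤ (ℕₚ.≰⇒> ∣C∣≰g) (ℕₚ.≤-reflexive (≡.sym ∣E∣≡g)))
                              (∣p∣+∣q∣≤∣r∣ C⊆V E⊆V (λ i∈C → proj₁ (∈-comprehension⁻ em i∈C)))
          ; more-than-g  = g<∣N≤t∣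
          }
          where
          agree : AgreeBefore t (play b) (play (plan E))
          agree i s x s<t = silence-agree (_< t) (λ r<s s<t → <-≤-trans r<s (proj₁ s<t))
            (λ s<t → proj₁ s<t ≲ t≤T) N<t⊆E i s x s<t

          C V : Subset n
          C = comprehension em (λ i → i ∉ E × i ∉ Y × ∃ λ s → 0# ≤ s × s ≤ T × track (play (plan E)) i s ≈ y)
          V = visitors Y (plan E) y (_≤ T)

          C⊆V : C ⊆ V
          C⊆V i∈C = ∈-comprehension⁺ em (proj₂ (∈-comprehension⁻ em i∈C))

          E⊆V : E ⊆ V
          E⊆V i∈E with ∈-comprehension⁻ em (E⊆N≤t i∈E)
          ... | i∉Y , s , 0≤s , s≤t , at = ∈-comprehension⁺ em
            (i∉Y , s , 0≤s , s≤t ≲ t≤T , ≈-trans (≈-sym (same-track agree _ 0≤s s≤t)) at)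

          -- Otherwise the announcers in C could be the faulty ones, with the target at z.
          ∣C∣≰g : ¬ (∣ C ∣ ℕ.≤ g)
          ∣C∣≰g ∣C∣≤g with complete (attacked E (ℕₚ.≤-reflexive ∣E∣≡g)) ≈-refl
          ... | t′ , t′≤T , (i , _ , s , 0≤s , s≤t′ , at , _) , certain =
            -- Certainty would identify `y` with `z`, yet robot `i` reached `y` by time `T`.
            far (plan E) i s 0≤s (s≤t′ ≲ t′≤T) (≈-trans at (≈-sym (certain elsewhere agree-elsewhere)))
            where
            lie : Robot → ℝ
            lie = override C y b
            honest : ∀ i → i ∉ Y ∪ C → lie i ≈ z
            honest i i∉ = ≈-trans
              (≡⇒≈ (override-∉ {b = b} (λ i∈C → i∉ (Subsetₚ.x∈p∪q⁺ {p = Y} (inj₂ i∈C)))))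
              (b≈z i (λ i∈Y → i∉ (Subsetₚ.x∈p∪q⁺ (inj₁ i∈Y))))
            elsewhere : Scenario A
            elsewhere = scenario lie z z≉0 (Y ∪ C) (∣Y∪E∣≤f ∣C∣≤g) honest
            same : ∀ i → plan E i ≈ lie i ⊎
                   (∀ s → 0# ≤ s → s ≤ T → track (play (plan E)) i s ≉ plan E i × track (play (plan E)) i s ≉ lie i)
            same i with i ∈? Subset.∁ (Y ∪ E) | i ∈? C
            ... | yes _  | yes _   = inj₁ ≈-refl
            ... | no _   | no _    = inj₁ ≈-refl
            ... | no  i∉ | yes i∈C = contradiction (Subsetₚ.x∉p⇒x∈∁p λ i∈ → case Subsetₚ.x∈p∪q⁻ Y E i∈ of λ
              { (inj₁ i∈Y) → proj₁ (proj₂ (∈-comprehension⁻ em i∈C)) i∈Y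
              ; (inj₂ i∈E) → proj₁ (∈-comprehension⁻ em i∈C) i∈E }) i∉
            -- A would-be announcer outside `C` does not reach `y` by time `T`, so its planning `z`
            -- instead is unobservable.
            ... | yes i∈ | no i∉C  = inj₂ λ s 0≤s s≤T →
              (λ at → i∉C (∈-comprehension⁺ em
                ( (λ i∈E → Subsetₚ.x∈∁p⇒x∉p i∈ (Subsetₚ.x∈p∪q⁺ {p = Y} (inj₂ i∈E))) , i∉Y , s , 0≤s , s≤T , at))) ,
              (λ at → far (plan E) i s 0≤s s≤T (≈-trans at (b≈z i i∉Y)))
              where
              i∉Y : i ∉ Y
              i∉Y i∈Y = Subsetₚ.x∈∁p⇒x∉p i∈ (Subsetₚ.x∈p∪q⁺ (inj₁ i∈Y))
            agree-elsewhere : AgreeUpTo t′ (messages (attacked E (ℕₚ.≤-reflexive ∣E∣≡g))) (messages elsewhere)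
            agree-elsewhere i s x s≤t′ = mk⇔
              (from (elsewhere⇔ i s x) ∘ to plays ∘ to (attacked⇔ i s x))
              (from (attacked⇔ i s x) ∘ from plays ∘ to (elsewhere⇔ i s x))
              where
              plays : play (plan E) i s x ⇔ play lie i s x
              plays = play-agree (plan E) lie (_≤ T) (λ r<s s≤T → proj₁ r<s ≲ s≤T) same i s x (s≤t′ ≲ t′≤T)
              attacked⇔ : ∀ i s x → messages (attacked E (ℕₚ.≤-reflexive ∣E∣≡g)) i s x ⇔ play (plan E) i s x
              attacked⇔ = messages-scenario (plan E) y y≉0 (Y ∪ E) (∣Y∪E∣≤f (ℕₚ.≤-reflexive ∣E∣≡g)) (plan-honest E)
              elsewhere⇔ : ∀ i s x → messages elsewhere i s x ⇔ play lie i s x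
              elsewhere⇔ = messages-scenario lie z z≉0 (Y ∪ C) (∣Y∪E∣≤f ∣C∣≤g) honest

    -- The attacks on the two sides and the resulting counts.

    module LowerBound (search : ∀ d → 0# < d → SearchTime≤ A d (2# * d)) where

      private
        σ̄ = opposite

        2*≈+ : ∀ d → 2# * d ≈ d + d
        2*≈+ d = ≈-trans (distribʳ d 1# 1#) (+-cong (*-identityˡ d) (*-identityˡ d))

        4# : ℝ
        4# = 2# + 2#

        0≤1 : 0# ≤ 1#
        0≤1 = proj₁ 0<1

        1≤2 : 1# ≤ 2#
        1≤2 = ≤-from 0≤1 (≈-sym (+-identityʳ 2#))

        2≤4 : 2# ≤ 4#
        2≤4 = ≤-from (0≤1 ≲ 1≤2) (≈-sym (+-identityʳ 4#))

        2*1≤2 : 2# * 1# ≤ 2#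
        2*1≤2 = ≤-reflexive (2*≈+ 1#)

        z : ℝ
        z = 1# + 4#

        4<z : 4# < z
        4<z = <-from 0<1 (≈-trans (+-comm 4# 1#) (≈-sym (+-identityʳ z)))

        idle : Robot → ℝ
        idle _ = z

        -- No search considered below lasts beyond time 4, so a robot whose plan is z
        -- stays silent.
        far : ∀ p i s → 0# ≤ s → s ≤ 4# → track (play p) i s ≉ z
        far p i s 0≤s s≤4 at = <⇒≱ 4<z (distance≤time right (trajectory A (play p) i) 0≤s at ≲ s≤4)

        point≉0 : ∀ σ {u} → 0# < u → point σ u ≉ 0#
        point≉0 right     (_ , 0≉u) u≈0  = 0≉u (≈-sym u≈0)
        point≉0 left  {u} (_ , 0≉u) -u≈0 =
          0≉u (≈-trans (≈-sym (-‿inverseʳ u)) (≈-trans (+-congˡ -u≈0) (+-identityʳ u)))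

        opaque
          attack-at : ∀ σ {u} → 0# < u → u ≤ 2# → ∀ {Y b g} → ∣ Y ∣ ℕ.+ g ℕ.≤ f → (∀ i → i ∉ Y → b i ≈ z) →
                      Attack Y b (point σ u) (2# * u) g
          attack-at σ {u} 0<u u≤2 {Y} {b} {g} ∣Y∣+g≤f b≈z =
            attack-exists Y b (point σ u) z (2# * u) g ∣Y∣+g≤f
              (point≉0 σ 0<u) (point≉0 right (≤-<-trans (0≤1 ≲ 1≤2 ≲ 2≤4) 4<z)) b≈z
              (λ p i s 0≤s s≤2u → far p i s 0≤s (s≤2u ≲ ≤-respˡ-≈ (≈-sym (2*≈+ u)) (+-mono-≤ u≤2 u≤2)))
              (λ S target≈ → search u 0<u S (on-side σ target≈))
            where
            on-side : ∀ σ {x} → x ≈ point σ u → x ≈ u ⊎ x ≈ - u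
            on-side right = inj₁
            on-side left  = inj₂

        module Side₁ (σ : Side) where

          -- The first attack starts from complete silence at distance 1, with the whole budget `f`
          -- available for silent robots.
          first : Attack Subset.⊥ idle (point σ 1#) (2# * 1#) f
          first = attack-at σ 0<1 1≤2 (ℕₚ.≤-reflexive (≡.cong (ℕ._+ f) (Subsetₚ.∣⊥∣≡0 n))) (λ _ _ → ≈-refl)

          open Attack first public using (time; silent; ∣silent∣; silent⊆; attack; agree)

          Early Visitors₁ : Subset n
          Early     = visitors Subset.⊥ idle (point σ 1#) (_≤ time)
          Visitors₁ = visitors Subset.⊥ attack (point σ 1#) (_≤ 2# * 1#)

        open Side₁

        module _ (σ : Side) (earlier : time σ ≤ time (σ̄ σ)) where

          -- Until `time (σ̄ σ)` the other attack looks like the idle play, so the early visit takes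
          -- place there too. Visiting both points takes at least time 1 + 2 = 3, beyond the
          -- deadline 2.
          early-misses-other-side : ∀ {i} → i ∈ Early σ → i ∉ Visitors₁ (σ̄ σ)
          early-misses-other-side {i} i∈ i∈′ with ∈-comprehension⁻ em i∈ | ∈-comprehension⁻ em i∈′
          ... | _ , s , 0≤s , s≤t , at | _ , s′ , 0≤s′ , s′≤2 , at′ = [ too-slow 1≤s s′≤2 , too-slow 1≤s′ s≤2 ]′
            (visits-both-sides σ τ {1#} {1#} 0≤s 0≤s′ at″ at′)
            where
            τ = trajectory A (play (attack (σ̄ σ))) i
            at″ : position τ s ≈ point σ 1#
            at″ = ≈-trans (≈-sym (same-track (agree (σ̄ σ)) i 0≤s (s≤t ≲ earlier))) at
            s≤2 = s≤t ≲ Attack.time≤T (first σ)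
            1≤s = distance≤time σ τ 0≤s at″
            1≤s′ = distance≤time (σ̄ σ) τ 0≤s′ at′
            too-slow : ∀ {r r′} → 1# ≤ r → r′ ≤ 2# * 1# → ¬ (1# + 1# + r ≤ r′)
            too-slow 1≤r r′≤2 h = a+b≰b 0<1
              (≤-respˡ-≈ (+-comm _ _) (+-mono-≤ ≤-refl 1≤r ≲ h ≲ r′≤2 ≲ 2*1≤2))

          ∣Early∣-bound : ∣ Early σ ∣ ℕ.+ (ℕ.suc f ℕ.+ f) ℕ.≤ n
          ∣Early∣-bound = ℕₚ.≤-trans (ℕₚ.+-monoʳ-≤ ∣ Early σ ∣ (Attack.many-visitors (first (σ̄ σ))))
            (ℕₚ.≤-trans (∣p∣+∣q∣≤∣r∣ Subsetₚ.⊆⊤ Subsetₚ.⊆⊤ early-misses-other-side) (ℕₚ.≤-reflexive (Subsetₚ.∣⊤∣≡n n)))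

        module Side₂ (σ : Side) (∣Early∣<2f+1 : ∣ Early σ ∣ ℕ.< ℕ.suc f ℕ.+ f) where

          private
            plan₁ : Robot → ℝ
            plan₁ = attack σ

          Arrives : Robot → ℝ → Set
          Arrives i s = i ∉ Early σ × Declares (λ _ → point σ 1#) (play plan₁) i s

          -- This bounds the first arrival outside `Early σ` by 2, which yields `u < 2#`.
          some-late-visitor : ∃ λ i → i ∈ Visitors₁ σ × i ∉ Early σ
          some-late-visitor = by-contradiction em λ ∄late → ℕₚ.<⇒≱ ∣Early∣<2f+1
            (ℕₚ.≤-trans (Attack.many-visitors (first σ)) (Subsetₚ.p⊆q⇒∣p∣≤∣q∣ λ {i} i∈V →
              decidable-stable (i ∈? Early σ) (λ i∉E → ∄late (i , i∈V , i∉E))))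

          opaque
            -- An arrival by `time σ` would follow the idle play and belong to `Early σ`, so the
            -- first arrival outside it comes strictly later, and `u` is chosen in between.
            -- Strictness matters: as `time σ` is at least 1, it makes `u` exceed 1.
            quiet-period : ∃ λ u → time σ < u × u < 2# ×
                           (∀ i → i ∉ Early σ → ∀ s → 0# ≤ s → s < u → track (play plan₁) i s ≉ point σ 1#)
            quiet-period with extremal-⋃ {P = Arrives}
                (λ i → extremal-≤1 _ (λ { (_ , a) (_ , a′) → declares-unique (λ _ → point σ 1#) {play plan₁} a a′ }))
              | some-late-visitor
            ... | ex | i , i∈V , i∉E with ∈-comprehension⁻ em i∈V
            ... | _ , s , 0≤s , s≤2 , at with first-visit-exists (trajectory A (play plan₁) i) 0≤s at
            ... | r , 0≤r , r≤s , first-r with ex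
            ... | inj₁ none = contradiction (i , i∉E , 0≤r , first-r) (none r)
            ... | inj₂ (v , (j , j∉E , 0≤v , first-v) , least) with between t<v
              where
              t<v : time σ < v
              t<v = ≰⇒> λ v≤t → j∉E (∈-comprehension⁺ em (Subsetₚ.∉⊥ , v , 0≤v , v≤t ,
                ≈-trans (same-track (agree σ) j 0≤v v≤t) (proj₁ first-v)))
            ... | u , t<u , u<v =
              u , t<u , <-≤-trans u<v (least r (i , i∉E , 0≤r , first-r) ≲ r≤s ≲ s≤2 ≲ 2*1≤2) , quiet
              where
              quiet : ∀ i → i ∉ Early σ → ∀ s → 0# ≤ s → s < u → track (play plan₁) i s ≉ point σ 1#
              quiet i i∉E s 0≤s s<u at with first-visit-exists (trajectory A (play plan₁) i) 0≤s at
              ... | r , 0≤r , r≤s , first-r =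
                <⇒≱ u<v (least r (i , i∉E , 0≤r , first-r) ≲ r≤s ≲ proj₁ s<u)

          u : ℝ
          u = proj₁ quiet-period

          t<u : time σ < u
          t<u = proj₁ (proj₂ quiet-period)

          u<2 : u < 2#
          u<2 = proj₁ (proj₂ (proj₂ quiet-period))

          quiet : ∀ i → i ∉ Early σ → ∀ s → 0# ≤ s → s < u → track (play plan₁) i s ≉ point σ 1#
          quiet = proj₂ (proj₂ (proj₂ quiet-period))

          1<u : 1# < u
          1<u with ∣p∣>k⇒nonempty (Early σ) (Attack.more-than-g (first σ))
          ... | i , i∈E with ∈-comprehension⁻ em i∈E
          ...   | _ , s , 0≤s , s≤t , at = ≤-<-trans (distance≤time σ (trajectory A (play idle) i) 0≤s at ≲ s≤t) t<u

          -- These robots announce by `time σ` in the first attack. In the second the target is on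
          -- the other side: they are faulty and use up part of the budget, while the silent robots
          -- of the first attack may be reliable.
          Liars : Subset n
          Liars = comprehension em (λ i → i ∈ Early σ × i ∉ silent σ)

          ∣Liars∣+f≤∣Early∣ : ∣ Liars ∣ ℕ.+ f ℕ.≤ ∣ Early σ ∣
          ∣Liars∣+f≤∣Early∣ = ≡.subst (λ k → ∣ Liars ∣ ℕ.+ k ℕ.≤ ∣ Early σ ∣) (∣silent∣ σ)
            (∣p∣+∣q∣≤∣r∣ (λ i∈ → proj₁ (∈-comprehension⁻ em i∈)) (silent⊆ σ) (λ i∈ → proj₂ (∈-comprehension⁻ em i∈)))

          ∣Liars∣≤f : ∣ Liars ∣ ℕ.≤ f
          ∣Liars∣≤f = ℕₚ.+-cancelʳ-≤ f _ _ (ℕ.s≤s⁻¹ (ℕₚ.≤-trans (ℕ.s≤s ∣Liars∣+f≤∣Early∣) ∣Early∣<2f+1))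

          budget : ℕ
          budget = f ℕ.∸ ∣ Liars ∣

          ∣Liars∣+budget≡f : ∣ Liars ∣ ℕ.+ budget ≡ f
          ∣Liars∣+budget≡f = ℕₚ.m+[n∸m]≡n ∣Liars∣≤f

          lies : Robot → ℝ
          lies = override Liars (point σ 1#) idle

          opaque
            second : Attack Liars lies (point (σ̄ σ) u) (2# * u) budget
            second = attack-at (σ̄ σ) (<-≤-trans 0<1 (proj₁ 1<u)) (proj₁ u<2) (ℕₚ.≤-reflexive ∣Liars∣+budget≡f)
              (λ i i∉ → ≡⇒≈ (override-∉ {b = idle} i∉))

          plan₂ : Robot → ℝ
          plan₂ = Attack.attack second

          Visitors₂ : Subset n
          Visitors₂ = visitors Liars plan₂ (point (σ̄ σ) u) (_≤ 2# * u)

          not-before-u : ∀ p i s → 0# ≤ s → s < u → track (play p) i s ≉ point (σ̄ σ) u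
          not-before-u p i s 0≤s s<u at = <⇒≱ s<u (distance≤time (σ̄ σ) (trajectory A (play p) i) 0≤s at)

          far-before-u : ∀ p i s → 0# ≤ s → s < u → track (play p) i s ≉ z
          far-before-u p i s 0≤s s<u = far p i s 0≤s (proj₁ s<u ≲ proj₁ u<2 ≲ 2≤4)

          ∉Early : ∀ {i} → i ∈ Subset.∁ (Subset.⊥ ∪ silent σ) → i ∉ Liars → i ∉ Early σ
          ∉Early i∈ i∉L i∈E = i∉L (∈-comprehension⁺ em
            (i∈E , λ i∈F → Subsetₚ.x∈∁p⇒x∉p i∈ (Subsetₚ.x∈p∪q⁺ {p = Subset.⊥} (inj₂ i∈F))))

          -- Members of `Liars` have the same plan twice. For any other robot whose plan changes,
          -- neither point is reached before `u`: `z` is too far, the point at distance `u` takes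
          -- time `u`, and `quiet` excludes `point σ 1#` outside `Early σ`.
          same-plans : ∀ i → plan₁ i ≈ plan₂ i ⊎
            (∀ s → 0# ≤ s → s < u → track (play plan₁) i s ≉ plan₁ i × track (play plan₁) i s ≉ plan₂ i)
          same-plans i
            with i ∈? Subset.∁ (Subset.⊥ ∪ silent σ) | i ∈? Subset.∁ (Liars ∪ Attack.silent second) | i ∈? Liars
          ... | no _ | no _ | no _ = inj₁ ≈-refl
          ... | yes _ | no _ | yes _ = inj₁ ≈-refl
          ... | _ | yes i∈ | yes i∈L = contradiction (Subsetₚ.x∈p∪q⁺ (inj₁ i∈L)) (Subsetₚ.x∈∁p⇒x∉p i∈)
          ... | no i∉ | no _ | yes i∈L = contradiction (Subsetₚ.x∉p⇒x∈∁p λ i∈ → case Subsetₚ.x∈p∪q⁻ Subset.⊥ _ i∈ of λ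
            { (inj₁ i∈⊥) → Subsetₚ.∉⊥ i∈⊥ ; (inj₂ i∈E) → proj₂ (∈-comprehension⁻ em i∈L) i∈E }) i∉
          ... | no _ | yes _ | no _ =
            inj₂ λ s 0≤s s<u → far-before-u plan₁ i s 0≤s s<u , not-before-u plan₁ i s 0≤s s<u
          ... | yes i∈ | yes _ | no i∉L =
            inj₂ λ s 0≤s s<u → quiet i (∉Early i∈ i∉L) s 0≤s s<u , not-before-u plan₁ i s 0≤s s<u
          ... | yes i∈ | no _ | no i∉L =
            inj₂ λ s 0≤s s<u → quiet i (∉Early i∈ i∉L) s 0≤s s<u , far-before-u plan₁ i s 0≤s s<u

          plans-agree : AgreeBefore u (play plan₁) (play plan₂)
          plans-agree i s x s<u =
            play-agree plan₁ plan₂ (_< u) (λ r<s s<u → <-≤-trans r<s (proj₁ s<u)) same-plans i s x s<u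

          -- The two plays share their motion until `u`. If the visit at distance 1 happens by then,
          -- both visits lie on one trajectory; going on to the other side would need
          -- `1 + u + 1 ≤ 2u`, against `u < 2`, and the reverse order is too slow as well. If it
          -- happens later, the two continuations from time `u` span a distance `1 + u` in total
          -- time at most `(2 - u) + (2u - u) = 2`, against `1 < u`.
          visitors-disjoint : ∀ {i} → i ∈ Visitors₁ σ → i ∉ Visitors₂
          visitors-disjoint {i} i∈₁ i∈₂ with ∈-comprehension⁻ em i∈₁ | ∈-comprehension⁻ em i∈₂
          ... | _ , s₁ , 0≤s₁ , s₁≤2 , at₁ | _ , s₂ , 0≤s₂ , s₂≤2u , at₂ with decide em (s₁ ≤ u)
          ... | yes s₁≤u = [ late₂ , late₁ ]′
                (visits-both-sides σ (trajectory A (play plan₂) i) {1#} {u} 0≤s₁ 0≤s₂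
                   (≈-trans (≈-sym (same-track plans-agree i 0≤s₁ s₁≤u)) at₁) at₂)
            where
            late₂ : ¬ (1# + u + s₁ ≤ s₂)
            late₂ h = <⇒≱ u<2 (≤-from (+-mono-≤ (≤-refl {1# + u}) 1≤s₁ ≲ h ≲ s₂≤2u ≲ ≤-reflexive (2*≈+ u))
              (solve 2 (λ e u → (e :+ e) :+ (u :+ u) := u :+ ((e :+ u) :+ e)) ≈-refl 1# u))
              where
              1≤s₁ : 1# ≤ s₁
              1≤s₁ = distance≤time σ (trajectory A (play plan₁) i) 0≤s₁ at₁
            late₁ : ¬ (1# + u + s₂ ≤ s₁)
            late₁ h = a+b≰b 0<1 (≤-respˡ-≈ (+-identityʳ _) (+-mono-≤ ≤-refl 0≤s₂ ≲ h ≲ s₁≤u))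
          -- The robot would have to go from one point to position q at time u and on to
          -- the other point, where q is its position at time u under both plans.
          ... | no s₁≰u = <⇒≱ 1<u (≤-from
                (opposite-sides-apart σ {1#} {u} (near-trans
                  (near-resp at₁ ≈-refl (near-sym (lipschitz (trajectory A (play plan₁) i) 0≤u u≤s₁)))
                  (near-resp (≈-sym (same-track plans-agree i 0≤u ≤-refl)) at₂
                    (lipschitz (trajectory A (play plan₂) i) 0≤u u≤s₂)))
                  ≲ +-mono-≤ (s₁≤2 ≲ 2*1≤2) (s₂≤2u ≲ ≤-reflexive (2*≈+ u)))
                (solve 2 (λ e u → u :+ ((e :+ e) :+ (u :+ u)) := e :+ (e :+ u :+ (u :+ u))) ≈-refl 1# u))
            where
            0≤u : 0# ≤ u
            0≤u = 0≤1 ≲ proj₁ 1<u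
            u≤s₁ : u ≤ s₁
            u≤s₁ = proj₁ (≰⇒> s₁≰u)
            u≤s₂ : u ≤ s₂
            u≤s₂ = distance≤time (σ̄ σ) (trajectory A (play plan₂) i) 0≤s₂ at₂

          visitors-bound : (ℕ.suc f ℕ.+ f) ℕ.+ (ℕ.suc budget ℕ.+ budget) ℕ.≤ n
          visitors-bound = ℕₚ.≤-trans (ℕₚ.+-mono-≤ (Attack.many-visitors (first σ)) (Attack.many-visitors second))
            (ℕₚ.≤-trans (∣p∣+∣q∣≤∣r∣ Subsetₚ.⊆⊤ Subsetₚ.⊆⊤ visitors-disjoint) (ℕₚ.≤-reflexive (Subsetₚ.∣⊤∣≡n n)))

        10f≤3n-on : ∀ σ → time σ ≤ time (σ̄ σ) → 10 ℕ.* f ℕ.≤ 3 ℕ.* n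
        10f≤3n-on σ earlier with ∣ Early σ ∣ ℕₚ.<? ℕ.suc f ℕ.+ f
        ... | no  ≮2f+1 = counting-majority {f = f} (ℕₚ.≮⇒≥ ≮2f+1) (∣Early∣-bound σ earlier)
        ... | yes <2f+1 = counting-split {f = f}
          ∣Liars∣+budget≡f ∣Liars∣+f≤∣Early∣ (∣Early∣-bound σ earlier) visitors-bound
          where open Side₂ σ <2f+1

      10f≤3n : 10 ℕ.* f ℕ.≤ 3 ℕ.* n
      10f≤3n = [ 10f≤3n-on left , 10f≤3n-on right ]′ (total (time left) (time right))

-- Passage to fractions.

open import Data.Rational.Base using (_/_; _≤_)

theorem6 : ExcludedMiddle (lsuc 0ℓ) →
    (R : RealNumbers) (n f : ℕ) → .{{_ : NonZero n}} →
    Search.S≤ R n f (RealNumbers.2# R) →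
    (+ f) / n ≤ (+ 3) / 10
theorem6 em R (ℕ.suc m) f (A , search) = ℚₚ.toℚᵘ-cancel-≤
  -- Unnormalised fractions are compared by cross multiplication; `mkℚᵘ` stores the denominator
  -- minus one, so `m` stands for `n` and `9` for 10.
  (ℚᵘₚ.≤-respˡ-≃ (ℚᵘₚ.≃-sym (ℚₚ.toℚᵘ-fromℚᵘ (mkℚᵘ (+ f) m)))
  (ℚᵘₚ.≤-respʳ-≃ (ℚᵘₚ.≃-sym (ℚₚ.toℚᵘ-fromℚᵘ (mkℚᵘ (+ 3) 9))) (*≤* f*10≤3*n)))
  where
  f*10≤3*n : + f ℤ.* + 10 ℤ.≤ + 3 ℤ.* + ℕ.suc m
  f*10≤3*n = ≡.subst₂ ℤ._≤_ (ℤₚ.pos-* f 10) (ℤₚ.pos-* 3 (ℕ.suc m))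
    (ℤ.+≤+ (ℕₚ.≤-trans (ℕₚ.≤-reflexive (ℕₚ.*-comm f 10))
      (Motion.Play.LowerBound.10f≤3n em R (ℕ.suc m) f A search)))
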